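{- Let $G$ be a finite simple connected graph. Then both $h(G)$ and $\chi(G)$ are bounded above by $B(G)$, i.e. $h(G)\le B(G)$ and $\chi(G)\le B(G)$.
   Context: All graphs are finite and simple. The Hadwiger number $h(G)$ is the maximum $t$ such that the complete graph $K^{t}$ is a minor of $G$; $\chi(G)$ is the chromatic number. For a connected graph $G=(V,E)$, the first upper bound of $G$ is $$B(G)=\left\lfloor\frac{3+\sqrt{9+8(|E|-|V|)}}{2}\right\rfloor.$$ -}

module Defs where

open import Data.Fin using (Fin)
open import Data.Fin.Properties using (_≟_; _<?_)
open import Data.Fin.Subset using (Subset; _∈_; _∩_; ⊤; Nonempty; Empty)
open import Data.List using (List; allFin; cartesianProduct; filter; length)
open import Data.Nat using (ℕ; zero; suc; _+_; _*_; _∸_; _/_; _^_; _≤_; _≤?_; z≤n; s≤s)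
  renaming (_<_ to _<ℕ_)
open import Data.Nat.DivMod using (/-mono-≤; m*n/n≡m; m/n*n≤m)
open import Data.Nat.Properties
  using ( ≤-refl; ≤-trans; ≰⇒>; <⇒≱; ≮⇒≥; n≤1+n; n<1+n; *-monoˡ-≤; +-monoʳ-≤
        ; ^-monoˡ-≤; ^-monoˡ-<; m≤n+m∸n; m≤n+o⇒m∸n≤o)
open import Data.Product using (∃; _×_; uncurry)
open import Function.Bundles using (_⇔_; mk⇔)
open import Level using (0ℓ)
open import Relation.Binary.Construct.Closure.ReflexiveTransitive using (Star)
open import Relation.Binary.Core using (Rel)
open import Relation.Binary.Definitions using (Decidable; Irreflexive; Symmetric)
open import Relation.Binary.PropositionalEquality
  using (_≡_; _≢_; subst; ≢-sym)
open import Relation.Nullary using (yes; no; ¬?)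
open import Relation.Nullary.Decidable using (_×-dec_)

-- Finite simple graphs on the vertex set Fin ∣V∣.
record Graph : Set₁ where
  field
    ∣V∣        : ℕ
    Adj        : Rel (Fin ∣V∣) 0ℓ
    adj?       : Decidable Adj
    adj-sym    : Symmetric Adj
    adj-irrefl : Irreflexive _≡_ Adj

  Vertex : Set
  Vertex = Fin ∣V∣

  -- Each edge {u , v} is listed once, as the pair with u < v.
  edges : List (Vertex × Vertex)
  edges = filter (uncurry λ u v → (u <? v) ×-dec adj? u v)
                 (cartesianProduct (allFin ∣V∣) (allFin ∣V∣))

  ∣E∣ : ℕ
  ∣E∣ = length edges

open Graph

-- Adjacency in the subgraph induced by U.
InducedAdj : (G : Graph) → Subset (∣V∣ G) → Rel (Vertex G) 0ℓ
InducedAdj G U u v = u ∈ U × v ∈ U × Adj G u v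

-- The subgraph induced by U is connected (in particular non-empty).
ConnectedOn : (G : Graph) → Subset (∣V∣ G) → Set
ConnectedOn G U =
  Nonempty U × (∀ {u v} → u ∈ U → v ∈ U → Star (InducedAdj G U) u v)

Connected : Graph → Set
Connected G = ConnectedOn G ⊤

-- H ≼ G: H is a minor of G, witnessed by connected, pairwise disjoint
-- branch sets in G indexed by the vertices of H.
record _≼_ (H G : Graph) : Set where
  field
    branch    : Vertex H → Subset (∣V∣ G)
    connected : ∀ x → ConnectedOn G (branch x)
    disjoint  : ∀ {x y} → x ≢ y → Empty (branch x ∩ branch y)
    adjacent  : ∀ {x y} → Adj H x y →
                ∃ λ u → ∃ λ v → u ∈ branch x × v ∈ branch y × Adj G u v

K : ℕ → Graph
K t = record
  { ∣V∣        = t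
  ; Adj        = _≢_
  ; adj?       = λ u v → ¬? (u ≟ v)
  ; adj-sym    = ≢-sym
  ; adj-irrefl = λ u≡v u≢v → u≢v u≡v
  }

IsHadwigerNumber : Graph → ℕ → Set
IsHadwigerNumber G h = K h ≼ G × (∀ t → K t ≼ G → t ≤ h)

Colourable : Graph → ℕ → Set
Colourable G k =
  ∃ λ (c : Vertex G → Fin k) → ∀ {u v} → Adj G u v → c u ≢ c v

IsChromaticNumber : Graph → ℕ → Set
IsChromaticNumber G k = Colourable G k × (∀ j → Colourable G j → k ≤ j)

-- Computes ⌊√ n⌋ from r = ⌊√ (n - 1)⌋.
√-step : ℕ → ℕ → ℕ
√-step n r with suc r ^ 2 ≤? n
... | yes _ = suc r
... | no  _ = r

⌊√_⌋ : ℕ → ℕ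
⌊√ zero  ⌋ = 0
⌊√ suc n ⌋ = √-step (suc n) ⌊√ n ⌋

⌊√⌋-lower : ∀ n → ⌊√ n ⌋ ^ 2 ≤ n
⌊√⌋-lower zero = z≤n
⌊√⌋-lower (suc n) with suc ⌊√ n ⌋ ^ 2 ≤? suc n
... | yes p = p
... | no  _ = ≤-trans (⌊√⌋-lower n) (n≤1+n n)

⌊√⌋-upper : ∀ n → n <ℕ suc ⌊√ n ⌋ ^ 2
⌊√⌋-upper zero = s≤s z≤n
⌊√⌋-upper (suc n) with suc ⌊√ n ⌋ ^ 2 ≤? suc n
... | yes _ = ≤-trans (s≤s (⌊√⌋-upper n))
                      (^-monoˡ-< 2 (n<1+n (suc ⌊√ n ⌋)))
... | no  p = ≰⇒> p

-- ⌊(3 + √ n) / 2⌋; taking the integer part of √ n first does not change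
-- the value, as ⌊[3+√]/2⌋-spec confirms.
⌊[3+√_]/2⌋ : ℕ → ℕ
⌊[3+√ n ]/2⌋ = (3 + ⌊√ n ⌋) / 2

-- b ≤ ⌊x⌋ ⇔ b ≤ x for x = (3 + √ n) / 2: the inequality b ≤ x says
-- 2b - 3 ≤ √ n, i.e. max(0 , 2b - 3)² ≤ n.
⌊[3+√]/2⌋-spec : ∀ n b → b ≤ ⌊[3+√ n ]/2⌋ ⇔ (b * 2 ∸ 3) ^ 2 ≤ n
⌊[3+√]/2⌋-spec n b = mk⇔ to from
  where
  r = ⌊√ n ⌋

  to : b ≤ (3 + r) / 2 → (b * 2 ∸ 3) ^ 2 ≤ n
  to p = ≤-trans
    (^-monoˡ-≤ 2 (m≤n+o⇒m∸n≤o (b * 2) 3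
      (≤-trans (*-monoˡ-≤ 2 p) (m/n*n≤m (3 + r) 2))))
    (⌊√⌋-lower n)

  from : (b * 2 ∸ 3) ^ 2 ≤ n → b ≤ (3 + r) / 2
  from p = subst (_≤ (3 + r) / 2) (m*n/n≡m b 2)
    (/-mono-≤ {o = 2} {p = 2}
      (≤-trans (m≤n+m∸n (b * 2) 3) (+-monoʳ-≤ 3 root)) ≤-refl)
    where
    root : b * 2 ∸ 3 ≤ r
    root = ≮⇒≥ λ r<x →
      <⇒≱ (⌊√⌋-upper n) (≤-trans (^-monoˡ-≤ 2 r<x) p)

-- The radicand is 9 + 8(∣E∣ - ∣V∣). For connected G the truncated
-- subtraction is exact, since ∣V∣ ≤ ∣E∣ + 1.
B : Graph → ℕ
B G = ⌊[3+√ (9 + 8 * ∣E∣ G) ∸ 8 * ∣V∣ G ]/2⌋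

{-# OPTIONS --safe #-}
-- For k ≥ 2, k ≤ B(G) says k(k - 3) ≤ 2(∣E∣ - ∣V∣). For a non-empty vertex set S
-- of a connected graph, ∣E(S)∣ - ∣S∣ ≤ ∣E∣ - ∣V∣: growing S to the whole graph one
-- adjacent vertex at a time adds an edge at every step. So it suffices to find
-- S with 2(∣E(S)∣ - ∣S∣) ≥ k(k - 3). For a K^k minor, S is the union of the
-- branch sets X: each has at least ∣X∣ - 1 edges, and there is an edge between
-- any two. For chromatic number k ≥ 3, S is a subgraph of minimum degree at
-- least k - 1, which exists since otherwise G has a greedy (k - 1)-colouring;
-- then 2(∣E(S)∣ - ∣S∣) ≥ ∣S∣(k - 3) and ∣S∣ ≥ k. For chromatic number 2, S is a
-- single vertex.

module Submission where

open import Defs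
open import Data.Nat using (ℕ; _≤_)
open import Data.Product using (_×_)

open import Algebra.Properties.Semiring.Sum using (*-distribˡ-sum)
open import Data.Bool using (true; false; if_then_else_)
open import Data.Empty using (⊥)
open import Data.Fin using (Fin; zero; suc)
open import Data.Fin.Properties using (_≟_; any?; ¬∀⟶∃¬; <-cmp)
  renaming (_<?_ to _<ᶠ?_)
open import Data.Fin.Subset using (Subset; ⊤; _∈_; _-_; ∣_∣)
open import Data.Fin.Subset.Properties
  using (_∈?_; ∈⊤; x∈p∩q⁺; x∈p∧x≢y⇒x∈p-y; x∈p⇒∣p-x∣<∣p∣)
open import Data.List using (_++_; filter; length; map; tabulate; allFin; cartesianProduct)
open import Data.List.Properties using (filter-++; length-++; map-tabulate)
open import Data.Nat using (zero; suc; _+_; _*_; _∸_; _^_; _<_; _<?_; _≤?_; z≤n; s≤s)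
open import Data.Nat.Induction using (<-wellFounded)
open import Data.Nat.Properties hiding (_≟_; _<?_; _≤?_; <-cmp)
open import Data.Nat.Tactic.RingSolver using (solve-∀)
open import Data.Product using (∃; ∃₂; _,_; proj₁; proj₂)
open import Data.Sum using (_⊎_; inj₁; inj₂)
open import Function using (_∘_; _$_; case_of_)
open import Function.Bundles using (module Equivalence)
open import Induction.WellFounded using (Acc; acc)
open import Level using (0ℓ)
open import Relation.Binary.Construct.Closure.ReflexiveTransitive using (Star; ε; _◅_)
open import Relation.Binary.Core using (Rel)
open import Relation.Binary.Definitions using (tri<; tri≈; tri>)
open import Relation.Binary.PropositionalEquality
open import Relation.Nullary using (Dec; yes; no; does; ¬_; contradiction; _×-dec_)
import Relation.Unary as U

open import Algebra.Properties.CommutativeMonoid.Sum +-0-commutativeMonoid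
  using (sum; sum-syntax; sum-cong-≗; ∑-distrib-+; ∑-comm)

private variable
  n t : ℕ

-- Iverson brackets and finite sums

𝟙 : ∀ {p} {P : Set p} → Dec P → ℕ
𝟙 P? = if does P? then 1 else 0

module _ {p} {P : Set p} where

  𝟙≤1 : (P? : Dec P) → 𝟙 P? ≤ 1
  𝟙≤1 (yes _) = ≤-refl
  𝟙≤1 (no  _) = z≤n

  𝟙⁺ : (P? : Dec P) → P → 1 ≤ 𝟙 P?
  𝟙⁺ (yes _)  _ = ≤-refl
  𝟙⁺ (no ¬p)  p = contradiction p ¬p

  𝟙⁻ : (P? : Dec P) → 1 ≤ 𝟙 P? → P
  𝟙⁻ (yes p) _ = p

sum-mono : {f g : Fin n → ℕ} → (∀ i → f i ≤ g i) → sum f ≤ sum g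
sum-mono {zero}  f≤g = z≤n
sum-mono {suc n} f≤g = +-mono-≤ (f≤g zero) (sum-mono (f≤g ∘ suc))

term≤sum : (f : Fin n → ℕ) → ∀ i → f i ≤ sum f
term≤sum f zero    = m≤m+n _ _
term≤sum f (suc i) = ≤-trans (term≤sum (f ∘ suc) i) (m≤n+m _ (f zero))

sum-const : ∀ n c → ∑[ i < n ] c ≡ n * c
sum-const zero    c = refl
sum-const (suc n) c = cong (c +_) (sum-const n c)

n≤sum : {f : Fin n → ℕ} → (∀ i → 1 ≤ f i) → n ≤ sum f
n≤sum {n} 1≤f = ≤-trans (≤-reflexive (sym (trans (sum-const n 1) (*-identityʳ n)))) (sum-mono 1≤f)

sum-zero : {f : Fin n → ℕ} → (∀ i → f i ≡ 0) → sum f ≡ 0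
sum-zero {n} f≡0 = trans (sum-cong-≗ f≡0) (trans (sum-const n 0) (*-zeroʳ n))

sum-*ˡ : ∀ c (f : Fin n → ℕ) → ∑[ i < n ] (c * f i) ≡ c * sum f
sum-*ˡ c f = sym (*-distribˡ-sum +-*-semiring c f)

sum-*ʳ : ∀ c (f : Fin n → ℕ) → ∑[ i < n ] (f i * c) ≡ sum f * c
sum-*ʳ c f = trans (sum-cong-≗ λ i → *-comm (f i) c) (trans (sum-*ˡ c f) (*-comm c (sum f)))

-- Once one term is positive, all later terms are forced to be 0. Applied to disjoint branch sets,
-- whose indicators then add up to an indicator.
sum≤1 : {f : Fin n → ℕ} → (∀ i → f i ≤ 1) →
        (∀ {i j} → i ≢ j → 1 ≤ f i → 1 ≤ f j → ⊥) → sum f ≤ 1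
sum≤1 {zero} _ _ = z≤n
sum≤1 {suc n} {f} f≤1 unique with f zero in eq | f≤1 zero
... | zero  | _ = sum≤1 (f≤1 ∘ suc) λ i≢j → unique λ { refl → i≢j refl }
... | suc _ | s≤s z≤n = s≤s $ ≤-reflexive $ sum-zero {f = f ∘ suc} λ i →
        n<1⇒n≡0 (≰⇒> (unique (λ ()) (subst (1 ≤_) (sym eq) (s≤s z≤n))))

δ : Fin n → Fin n → ℕ
δ i j = 𝟙 (i ≟ j)

sum-δ : (i : Fin n) → sum (δ i) ≡ 1
sum-δ {suc n} zero    = cong suc (sum-zero {n} {f = λ j → δ zero (suc j)} λ _ → refl)
sum-δ (suc i) = sum-δ i

-- Vertex sets are handled as functions to ℕ: adding a new vertex or uniting disjoint sets becomes
-- pointwise addition, in which edge counts are bilinear.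
infixl 6 _⊕_
_⊕_ : (a b : Fin n → ℕ) → Fin n → ℕ
(a ⊕ b) v = a v + b v

𝟏 : Subset n → Fin n → ℕ
𝟏 S v = 𝟙 (v ∈? S)

δ≤𝟏 : {S : Subset n} {s : Fin n} → s ∈ S → ∀ v → δ s v ≤ 𝟏 S v
δ≤𝟏 {S = S} {s} s∈S v with s ≟ v
... | yes refl = 𝟙⁺ (v ∈? S) s∈S
... | no  _    = z≤n

-- Follow the path to the first step that leaves `P`.
crossing : ∀ {A : Set} {R : Rel A 0ℓ} {P : A → Set} → U.Decidable P →
           ∀ {s w} → Star R s w → P s → ¬ P w → ∃₂ λ x y → R x y × P x × ¬ P y
crossing P? ε ps ¬pw = contradiction ps ¬pw
crossing P? (_◅_ {j = y} r rs) ps ¬pw with P? y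
... | yes py = crossing P? rs py ¬pw
... | no ¬py = _ , y , r , ps , ¬py

-- Counting with filters

module _ {A : Set} {P : A → Set} (P? : U.Decidable P) where

  length-filter-tabulate : (f : Fin n → A) →
    length (filter P? (tabulate f)) ≡ ∑[ i < n ] 𝟙 (P? (f i))
  length-filter-tabulate {zero}  f = refl
  length-filter-tabulate {suc n} f with does (P? (f zero))
  ... | true  = cong suc (length-filter-tabulate (f ∘ suc))
  ... | false = length-filter-tabulate (f ∘ suc)

-- Turns `∣E∣`, a list length, into a double sum. The general `f` lets the recursion drop the first
-- row by passing to `f ∘ suc`.
length-filter-cartesianProduct : ∀ {m n} {A : Set} {P : A × Fin n → Set} (P? : U.Decidable P) (f : Fin m → A) →
  length (filter P? (cartesianProduct (tabulate f) (allFin n))) ≡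
  ∑[ i < m ] ∑[ j < n ] 𝟙 (P? (f i , j))
length-filter-cartesianProduct {zero} P? f = refl
length-filter-cartesianProduct {suc m} {n} P? f = begin
  length (filter P? (row ++ rest))                   ≡⟨ cong length (filter-++ P? row rest) ⟩
  length (filter P? row ++ filter P? rest)           ≡⟨ length-++ (filter P? row) ⟩
  length (filter P? row) + length (filter P? rest)
    ≡⟨ cong₂ _+_ (trans (cong (length ∘ filter P?) (map-tabulate (λ j → j) (f zero ,_)))
                        (length-filter-tabulate P? (f zero ,_)))
                 (length-filter-cartesianProduct P? (f ∘ suc)) ⟩
  _ ∎
  where
  open ≡-Reasoning
  row  = map (f zero ,_) (allFin n)
  rest = cartesianProduct (tabulate (f ∘ suc)) (allFin n)

-- Counting adjacent pairs

module _ (G : Graph) where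
  open Graph G

  A : Vertex → Vertex → ℕ
  A u v = 𝟙 (adj? u v)

  -- For a = 𝟏 S, the number of neighbours in S.
  N : (Vertex → ℕ) → Vertex → ℕ
  N a u = ∑[ v < ∣V∣ ] (A u v * a v)

  -- For a = 𝟏 S and b = 𝟏 T, the number of adjacent pairs in S × T; in
  -- particular e (𝟏 S) (𝟏 S) counts each edge inside S twice.
  e : (a b : Vertex → ℕ) → ℕ
  e a b = ∑[ u < ∣V∣ ] (a u * N b u)

  N-⊕ : ∀ a b u → N (a ⊕ b) u ≡ N a u + N b u
  N-⊕ a b u = trans (sum-cong-≗ λ v → *-distribˡ-+ (A u v) (a v) (b v))
    (∑-distrib-+ (λ v → A u v * a v) (λ v → A u v * b v))

  e-⊕ˡ : ∀ a b c → e (a ⊕ b) c ≡ e a c + e b c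
  e-⊕ˡ a b c = trans (sum-cong-≗ λ u → *-distribʳ-+ (N c u) (a u) (b u))
    (∑-distrib-+ (λ u → a u * N c u) (λ u → b u * N c u))

  e-⊕ʳ : ∀ a b c → e a (b ⊕ c) ≡ e a b + e a c
  e-⊕ʳ a b c = trans (sum-cong-≗ λ u →
    trans (cong (a u *_) (N-⊕ b c u)) (*-distribˡ-+ (a u) (N b u) (N c u)))
    (∑-distrib-+ (λ u → a u * N b u) (λ u → a u * N c u))

  e-sumˡ : (x : Fin t → Vertex → ℕ) → ∀ c → ∑[ i < t ] e (x i) c ≤ e (λ v → ∑[ i < t ] x i v) c
  e-sumˡ {zero}  x c = z≤n
  e-sumˡ {suc t} x c = ≤-trans (+-monoʳ-≤ _ (e-sumˡ (x ∘ suc) c)) (≤-reflexive (sym (e-⊕ˡ (x zero) (λ v → ∑[ i < t ] x (suc i) v) c)))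

  e-sumʳ : ∀ a (x : Fin t → Vertex → ℕ) → ∑[ i < t ] e a (x i) ≤ e a (λ v → ∑[ i < t ] x i v)
  e-sumʳ {zero}  a x = z≤n
  e-sumʳ {suc t} a x = ≤-trans (+-monoʳ-≤ _ (e-sumʳ a (x ∘ suc))) (≤-reflexive (sym (e-⊕ʳ a (x zero) (λ v → ∑[ i < t ] x (suc i) v))))

  e-mono : ∀ {a a′ b b′} → (∀ v → a v ≤ a′ v) → (∀ v → b v ≤ b′ v) → e a b ≤ e a′ b′
  e-mono a≤a′ b≤b′ = sum-mono λ u → *-mono-≤ (a≤a′ u) (sum-mono λ v → *-monoʳ-≤ (A u v) (b≤b′ v))

  e-pos : ∀ {a b u v} → 1 ≤ a u → Adj u v → 1 ≤ b v → 1 ≤ e a b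
  e-pos {a} {b} {u} {v} 1≤a uv 1≤b = ≤-trans
    (*-mono-≤ 1≤a (≤-trans (*-mono-≤ (𝟙⁺ (adj? u v) uv) 1≤b) (term≤sum (λ v → A u v * b v) v)))
    (term≤sum (λ u → a u * N b u) u)

  ∣E∣≡sum : ∣E∣ ≡ ∑[ u < ∣V∣ ] ∑[ v < ∣V∣ ] 𝟙 ((u <ᶠ? v) ×-dec adj? u v)
  ∣E∣≡sum = length-filter-cartesianProduct (λ (u , v) → (u <ᶠ? v) ×-dec adj? u v) (λ u → u)

  -- Every ordered adjacent pair either has u < v, as in `edges`, or is the reverse of such a pair;
  -- exchanging the two sums shows that both kinds number `∣E∣`.
  e≤2∣E∣ : ∀ {a b} → (∀ v → a v ≤ 1) → (∀ v → b v ≤ 1) → e a b ≤ 2 * ∣E∣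
  e≤2∣E∣ {a} {b} a≤1 b≤1 = begin
    e a b
      ≤⟨ sum-mono (λ u → ≤-trans (*-mono-≤ (a≤1 u) (sum-mono λ v → *-mono-≤ (orient u v) (b≤1 v)))
           (≤-reflexive (trans (*-identityˡ _) (sum-cong-≗ {∣V∣} λ v → *-identityʳ _)))) ⟩
    ∑[ u < ∣V∣ ] ∑[ v < ∣V∣ ] (F u v + F v u)
      ≡⟨ trans (sum-cong-≗ λ u → ∑-distrib-+ (F u) (λ v → F v u)) (∑-distrib-+ (λ u → sum (F u)) _) ⟩
    ∑[ u < ∣V∣ ] ∑[ v < ∣V∣ ] F u v + ∑[ u < ∣V∣ ] ∑[ v < ∣V∣ ] F v u
      ≡⟨ cong₂ _+_ (sym ∣E∣≡sum) (trans (∑-comm (λ u v → F v u)) (sym ∣E∣≡sum)) ⟩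
    ∣E∣ + ∣E∣
      ≡⟨ cong (∣E∣ +_) (sym (+-identityʳ ∣E∣)) ⟩
    2 * ∣E∣ ∎
    where
    open ≤-Reasoning
    F? : ∀ u v → Dec _
    F? u v = (u <ᶠ? v) ×-dec adj? u v
    F : Vertex → Vertex → ℕ
    F u v = 𝟙 (F? u v)
    orient : ∀ u v → A u v ≤ F u v + F v u
    orient u v with adj? u v
    ... | no  _  = z≤n
    ... | yes uv with <-cmp u v
    ...   | tri< u<v _ _ = ≤-trans (𝟙⁺ ((u <ᶠ? v) ×-dec yes uv) (u<v , uv)) (m≤m+n _ _)
    ...   | tri≈ _ u≡v _ = contradiction uv (adj-irrefl u≡v)
    ...   | tri> _ _ v<u = ≤-trans (𝟙⁺ (F? v u) (v<u , adj-sym uv)) (m≤n+m _ _)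

  -- Growing connected sets

  -- A connected set T is reached from any non-empty part of it by adding one
  -- vertex at a time, and each added vertex brings at least one new edge.
  grow : ∀ {T a s} → ConnectedOn G T → (∀ v → a v ≤ 𝟏 T v) → 1 ≤ a s →
         e a a + 2 * sum (𝟏 T) ≤ e (𝟏 T) (𝟏 T) + 2 * sum a
  grow {T} conn a≤T 1≤as = go (<-wellFounded _) a≤T 1≤as
    where
    go : ∀ {a s} → Acc _<_ (sum (𝟏 T) ∸ sum a) → (∀ v → a v ≤ 𝟏 T v) → 1 ≤ a s →
         e a a + 2 * sum (𝟏 T) ≤ e (𝟏 T) (𝟏 T) + 2 * sum a
    go {a} {s} (acc rec) a≤T 1≤as with any? (λ w → a w <? 𝟏 T w)
    -- Nothing is missing: `𝟏 T` is also a lower bound for `a`.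
    ... | no full = +-mono-≤ (e-mono a≤T a≤T)
                      (*-monoʳ-≤ 2 (sum-mono λ w → ≮⇒≥ λ lt → full (w , lt)))
    ... | yes (w , aw<Tw)
      -- A path inside `T` from `s` to the missing vertex `w` has an edge `xy` that leaves the
      -- support of `a`; its end `y` is the vertex to add.
      with crossing (λ v → 1 ≤? a v)
             (proj₂ conn (𝟙⁻ (s ∈? T) (≤-trans 1≤as (a≤T s)))
                         (𝟙⁻ (w ∈? T) (≤-trans (s≤s z≤n) aw<Tw)))
             1≤as (λ 1≤aw → <⇒≱ aw<Tw (≤-trans (𝟙≤1 (w ∈? T)) 1≤aw))
    -- The edge `xy` counts once in `e a (δ y)` and once in `e (δ y) a`; these 2 pay for the growth
    -- of `2 * sum a` by 2.
    ... | x , y , (_ , y∈T , xy) , 1≤ax , 1≰ay = +-cancelˡ-≤ 2 _ _ (begin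
      2 + (e a a + 2 * sum (𝟏 T))              ≡⟨ arrange (e a a) (2 * sum (𝟏 T)) ⟩
      ((e a a + 1) + (1 + 0)) + 2 * sum (𝟏 T)  ≤⟨ +-monoˡ-≤ _ (+-mono-≤ (+-monoʳ-≤ (e a a) (e-pos {a} {δ y} {x} {y} 1≤ax xy δyy))
                                                   (+-mono-≤ (e-pos {δ y} {a} {y} {x} δyy (adj-sym xy) 1≤ax) z≤n)) ⟩
      ((e a a + e a (δ y)) + (e (δ y) a + e (δ y) (δ y))) + 2 * sum (𝟏 T)
                                               ≡⟨ cong (_+ 2 * sum (𝟏 T)) (sym expand) ⟩
      e a′ a′ + 2 * sum (𝟏 T)                  ≤⟨ go (rec (∸-monoʳ-< suma< (sum-mono a′≤T))) a′≤T
                                                     (≤-trans 1≤ax (m≤m+n (a x) (δ y x))) ⟩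
      e (𝟏 T) (𝟏 T) + 2 * sum a′               ≡⟨ cong (λ z → e (𝟏 T) (𝟏 T) + 2 * z) suma′ ⟩
      e (𝟏 T) (𝟏 T) + 2 * (sum a + 1)          ≡⟨ arrange′ (e (𝟏 T) (𝟏 T)) (sum a) ⟩
      2 + (e (𝟏 T) (𝟏 T) + 2 * sum a)          ∎)
      where
      open ≤-Reasoning
      a′ = a ⊕ δ y
      δyy : 1 ≤ δ y y
      δyy = 𝟙⁺ (y ≟ y) refl
      suma′ : sum a′ ≡ sum a + 1
      suma′ = trans (∑-distrib-+ a (δ y)) (cong (sum a +_) (sum-δ y))
      suma< : sum a < sum a′
      suma< = ≤-reflexive (trans (+-comm 1 (sum a)) (sym suma′))
      a′≤T : ∀ v → a′ v ≤ 𝟏 T v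
      a′≤T v with y ≟ v
      ... | yes refl = ≤-trans (≤-reflexive (cong (_+ 1) (n<1⇒n≡0 (≰⇒> 1≰ay)))) (𝟙⁺ (y ∈? T) y∈T)
      ... | no  _    = ≤-trans (≤-reflexive (+-identityʳ (a v))) (a≤T v)
      expand : e a′ a′ ≡ (e a a + e a (δ y)) + (e (δ y) a + e (δ y) (δ y))
      expand = trans (e-⊕ˡ a (δ y) a′) (cong₂ _+_ (e-⊕ʳ a a (δ y)) (e-⊕ʳ (δ y) a (δ y)))
      arrange : ∀ p q → 2 + (p + q) ≡ ((p + 1) + (1 + 0)) + q
      arrange = solve-∀
      arrange′ : ∀ p q → p + 2 * (q + 1) ≡ 2 + (p + 2 * q)
      arrange′ = solve-∀

  -- For `a = 𝟏 S` this is ∣E(S)∣ - ∣S∣ ≤ ∣E∣ - ∣V∣, doubled and free of subtraction. It is `grow`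
  -- up to the full vertex set.
  spanning : ∀ a {s} → Connected G → (∀ v → a v ≤ 1) → 1 ≤ a s →
             e a a + 2 * ∣V∣ ≤ 2 * ∣E∣ + 2 * sum a
  spanning a conn a≤1 1≤as = begin
    e a a + 2 * ∣V∣              ≤⟨ +-monoʳ-≤ (e a a) (*-monoʳ-≤ 2 (n≤sum ⊤≥1)) ⟩
    e a a + 2 * sum (𝟏 (⊤ {∣V∣}))  ≤⟨ grow conn (λ v → ≤-trans (a≤1 v) (⊤≥1 v)) 1≤as ⟩
    e (𝟏 ⊤) (𝟏 ⊤) + 2 * sum a    ≤⟨ +-monoˡ-≤ (2 * sum a) (e≤2∣E∣ ⊤≤1 ⊤≤1) ⟩
    2 * ∣E∣ + 2 * sum a          ∎
    where
    open ≤-Reasoning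
    ⊤≥1 : ∀ v → 1 ≤ 𝟏 ⊤ v
    ⊤≥1 v = 𝟙⁺ (v ∈? ⊤) ∈⊤
    ⊤≤1 : ∀ v → 𝟏 ⊤ v ≤ 1
    ⊤≤1 v = 𝟙≤1 (v ∈? ⊤)

  -- Reduction of the bound to an edge count

  -- k(k - 3) ≤ 2(∣E∣ - ∣V∣), with all terms moved to avoid subtraction.
  ≤B : ∀ k → (2 ≤ k → k * k + 2 * ∣V∣ ≤ 2 * ∣E∣ + 3 * k) → k ≤ B G
  ≤B k key = Equivalence.from (⌊[3+√]/2⌋-spec ((9 + 8 * ∣E∣) ∸ 8 * ∣V∣) k) (squared k key)
    where
    squared : ∀ k → (2 ≤ k → k * k + 2 * ∣V∣ ≤ 2 * ∣E∣ + 3 * k) →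
              (k * 2 ∸ 3) ^ 2 ≤ (9 + 8 * ∣E∣) ∸ 8 * ∣V∣
    -- For k ≤ 1 the truncated 2k - 3 is 0.
    squared zero _ = z≤n
    squared (suc zero) _ = z≤n
    -- With k = m + 2, 2k - 3 is 2m + 1. Since (2k - 3)² = 4k² - (12k - 9), the goal is four times
    -- `key` after adding 12k - 9 = 12m + 15 to both sides.
    squared k@(suc (suc m)) key = m+n≤o⇒m≤o∸n (suc (m * 2) ^ 2)
      (+-cancelˡ-≤ (12 * m + 15) _ _ (begin
        12 * m + 15 + (suc (m * 2) ^ 2 + 8 * ∣V∣)  ≡⟨ lhs m ∣V∣ ⟩
        4 * (k * k + 2 * ∣V∣)                      ≤⟨ *-monoʳ-≤ 4 (key (s≤s (s≤s z≤n))) ⟩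
        4 * (2 * ∣E∣ + 3 * k)                      ≡⟨ rhs m ∣E∣ ⟩
        12 * m + 15 + (9 + 8 * ∣E∣)                ∎))
      where
      open ≤-Reasoning
      lhs : ∀ m v → 12 * m + 15 + (suc (m * 2) * (suc (m * 2) * 1) + 8 * v) ≡ 4 * (suc (suc m) * suc (suc m) + 2 * v)
      lhs = solve-∀
      rhs : ∀ m w → 4 * (2 * w + 3 * suc (suc m)) ≡ 12 * m + 15 + (9 + 8 * w)
      rhs = solve-∀

  -- Complete minors

  -- For i ≠ j an edge joins the two branch sets. For i = j, growing X from a single vertex gives
  -- 2∣X∣ ≤ `e X X` + 2. The factors `δ i j` merge both cases into one inequality that can be summed
  -- over j.
  branch-pair : (M : K t ≼ G) → let open _≼_ M in ∀ i j →
    1 + δ i j * (2 * sum (𝟏 (branch i))) ≤ e (𝟏 (branch i)) (𝟏 (branch j)) + δ i j * 3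
  branch-pair M i j with i ≟ j
  ... | no i≢j with u , v , u∈ , v∈ , uv ← _≼_.adjacent M i≢j =
        +-mono-≤ (e-pos {𝟏 (branch i)} {𝟏 (branch j)} (𝟙⁺ (u ∈? branch i) u∈) uv (𝟙⁺ (v ∈? branch j) v∈)) z≤n
    where open _≼_ M
  ... | yes refl with (s , s∈X) , _ ← _≼_.connected M i = begin
    1 + (2 * sum X + 0)               ≡⟨ cong suc (+-identityʳ _) ⟩
    1 + 2 * sum X                     ≤⟨ +-monoʳ-≤ 1 (m≤n+m _ (e (δ s) (δ s))) ⟩
    1 + (e (δ s) (δ s) + 2 * sum X)   ≤⟨ +-monoʳ-≤ 1 (grow (_≼_.connected M i) (δ≤𝟏 s∈X) (𝟙⁺ (s ≟ s) refl)) ⟩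
    1 + (e X X + 2 * sum (δ s))       ≡⟨ cong (λ z → 1 + (e X X + 2 * z)) (sum-δ s) ⟩
    1 + (e X X + 2)                   ≡⟨ sym (+-suc (e X X) 2) ⟩
    e X X + 3                         ∎
    where
    open ≤-Reasoning
    X = 𝟏 (_≼_.branch M i)

  -- The indicator function of the union of the branch sets, as they are disjoint.
  branches : (M : K t ≼ G) → Vertex → ℕ
  branches {t} M v = ∑[ i < t ] 𝟏 (_≼_.branch M i) v

  branches≤1 : (M : K t ≼ G) → ∀ v → branches M v ≤ 1
  branches≤1 M v = sum≤1 (λ i → 𝟙≤1 (v ∈? branch i)) λ {i} {j} i≢j v∈i v∈j →
    disjoint i≢j (v , x∈p∩q⁺ (𝟙⁻ (v ∈? branch i) v∈i , 𝟙⁻ (v ∈? branch j) v∈j))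
    where open _≼_ M

  -- Sum `branch-pair` over j, where the `δ i j` terms survive only at j = i, and then over i.
  e-branches : (M : K t ≼ G) → t * t + 2 * sum (branches M) ≤ e (branches M) (branches M) + 3 * t
  e-branches {t} M = begin
    t * t + 2 * sum (branches M)
      ≡⟨ cong₂ _+_ (sym (sum-const t t)) (trans (cong (2 *_) (∑-comm (λ v i → x i v))) (sym (sum-*ˡ 2 (λ i → sum (x i))))) ⟩
    ∑[ i < t ] t + ∑[ i < t ] (2 * sum (x i))
      ≡⟨ sym (∑-distrib-+ {t} (λ _ → t) (λ i → 2 * sum (x i))) ⟩
    ∑[ i < t ] (t + 2 * sum (x i))
      ≤⟨ sum-mono {t} row ⟩
    ∑[ i < t ] (e (x i) (branches M) + 3)
      ≡⟨ trans (∑-distrib-+ {t} (λ i → e (x i) (branches M)) (λ _ → 3))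
           (cong (∑[ i < t ] e (x i) (branches M) +_) (trans (sum-const t 3) (*-comm t 3))) ⟩
    ∑[ i < t ] e (x i) (branches M) + 3 * t
      ≤⟨ +-monoˡ-≤ (3 * t) (e-sumˡ x (branches M)) ⟩
    e (branches M) (branches M) + 3 * t ∎
    where
    open ≤-Reasoning
    x : Fin t → Vertex → ℕ
    x i = 𝟏 (_≼_.branch M i)
    pick : ∀ i c → ∑[ j < t ] (δ i j * c) ≡ c
    pick i c = trans (sum-*ʳ c (δ i)) (trans (cong (_* c) (sum-δ i)) (*-identityˡ c))
    row : ∀ i → t + 2 * sum (x i) ≤ e (x i) (branches M) + 3
    row i = begin
      t + 2 * sum (x i)
        ≡⟨ cong₂ _+_ (sym (trans (sum-const t 1) (*-identityʳ t))) (sym (pick i (2 * sum (x i)))) ⟩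
      ∑[ j < t ] 1 + ∑[ j < t ] (δ i j * (2 * sum (x i)))
        ≡⟨ sym (∑-distrib-+ {t} (λ _ → 1) _) ⟩
      ∑[ j < t ] (1 + δ i j * (2 * sum (x i)))
        ≤⟨ sum-mono (branch-pair M i) ⟩
      ∑[ j < t ] (e (x i) (x j) + δ i j * 3)
        ≡⟨ trans (∑-distrib-+ (λ j → e (x i) (x j)) _) (cong (∑[ j < t ] e (x i) (x j) +_) (pick i 3)) ⟩
      ∑[ j < t ] e (x i) (x j) + 3
        ≤⟨ +-monoˡ-≤ 3 (e-sumʳ (x i) x) ⟩
      e (x i) (branches M) + 3 ∎

  complete-minor≤B : Connected G → K t ≼ G → t ≤ B G
  -- Matching on 2 ≤ t exposes t as a successor, so branch set `zero` exists; its vertex `s`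
  -- supplies the positive value that `spanning` asks for.
  complete-minor≤B {t} conn M = ≤B t λ { (s≤s _) → case _≼_.connected M zero of λ
    { ((s , s∈X) , _) → +-cancelʳ-≤ (2 * sum (branches M)) _ _ (begin
      t * t + 2 * ∣V∣ + 2 * sum (branches M)            ≡⟨ swap (t * t) (2 * ∣V∣) (2 * sum (branches M)) ⟩
      t * t + 2 * sum (branches M) + 2 * ∣V∣            ≤⟨ +-monoˡ-≤ (2 * ∣V∣) (e-branches M) ⟩
      e (branches M) (branches M) + 3 * t + 2 * ∣V∣     ≡⟨ swap (e (branches M) (branches M)) (3 * t) (2 * ∣V∣) ⟩
      e (branches M) (branches M) + 2 * ∣V∣ + 3 * t     ≤⟨ +-monoˡ-≤ (3 * t) (spanning (branches M) {s} conn (branches≤1 M)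
                                                             (≤-trans (𝟙⁺ (s ∈? _) s∈X) (term≤sum (λ i → 𝟏 (_≼_.branch M i) s) zero))) ⟩
      2 * ∣E∣ + 2 * sum (branches M) + 3 * t            ≡⟨ swap (2 * ∣E∣) (2 * sum (branches M)) (3 * t) ⟩
      2 * ∣E∣ + 3 * t + 2 * sum (branches M)            ∎) } }
    where
    open ≤-Reasoning
    swap : ∀ p q r → p + q + r ≡ p + r + q
    swap = solve-∀

  -- Colourings

  ColourableOn : Subset ∣V∣ → ℕ → Set
  ColourableOn S k = ∃ λ (c : Vertex → Fin k) → ∀ {u v} → u ∈ S → v ∈ S → Adj u v → c u ≢ c v

  -- Pigeonhole by double counting: sum over pairs of a neighbour in S and its colour. Grouped by
  -- neighbour this is `N (𝟏 S) u`; grouped by colour it would be at least k if no colour were free.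
  free-colour : ∀ {k} S u (c : Vertex → Fin k) → N (𝟏 S) u < k →
                ∃ λ i → ∀ v → v ∈ S → Adj u v → c v ≢ i
  free-colour {k} S u c N<k = case ¬∀⟶∃¬ k Used used? (λ used → <⇒≱ N<k (k≤N used)) of λ
    { (i , unused) → i , λ v v∈S uv cv≡i → unused (v , v∈S , uv , cv≡i) }
    where
    Used : Fin k → Set
    Used i = ∃ λ v → v ∈ S × Adj u v × c v ≡ i
    used? : U.Decidable Used
    used? i = any? λ v → (v ∈? S) ×-dec adj? u v ×-dec (c v ≟ i)
    open ≤-Reasoning
    term : Vertex → Fin k → ℕ
    term v i = A u v * 𝟏 S v * δ (c v) i
    k≤N : (∀ i → Used i) → k ≤ N (𝟏 S) u
    k≤N used = begin
      k                                    ≤⟨ n≤sum (λ i → case used i of λ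
                                                { (v , v∈S , uv , cv≡i) → ≤-trans
                                                    (*-mono-≤ (*-mono-≤ (𝟙⁺ (adj? u v) uv) (𝟙⁺ (v ∈? S) v∈S)) (𝟙⁺ (c v ≟ i) cv≡i))
                                                    (term≤sum (λ v → term v i) v) }) ⟩
      ∑[ i < k ] ∑[ v < ∣V∣ ] term v i     ≡⟨ ∑-comm (λ i v → term v i) ⟩
      ∑[ v < ∣V∣ ] ∑[ i < k ] term v i     ≡⟨ sum-cong-≗ {∣V∣} (λ v → trans (sum-*ˡ (A u v * 𝟏 S v) (δ (c v)))
                                                (trans (cong (A u v * 𝟏 S v *_) (sum-δ (c v))) (*-identityʳ _))) ⟩
      N (𝟏 S) u                            ∎

  colour-vertex : ∀ {k} S u → N (𝟏 S) u < k → ColourableOn (S - u) k → ColourableOn S k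
  colour-vertex {k} S u N<k (c , proper) with i , free ← free-colour S u c N<k
    = c′ , proper′
    where
    c′ : Vertex → Fin k
    c′ v = if does (v ≟ u) then i else c v
    proper′ : ∀ {v w} → v ∈ S → w ∈ S → Adj v w → c′ v ≢ c′ w
    proper′ {v} {w} v∈S w∈S vw with v ≟ u | w ≟ u
    ... | yes refl | yes refl = contradiction vw (adj-irrefl refl)
    ... | yes refl | no _     = ≢-sym (free w w∈S vw)
    ... | no _     | yes refl = free v v∈S (adj-sym vw)
    ... | no v≢u   | no w≢u   = proper (x∈p∧x≢y⇒x∈p-y v∈S v≢u) (x∈p∧x≢y⇒x∈p-y w∈S w≢u) vw

  -- Subgraphs of large minimum degree

  MinDegree≥ : ℕ → Subset ∣V∣ → Set
  MinDegree≥ k S = ∀ {u} → u ∈ S → k ≤ N (𝟏 S) u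

  -- Delete vertices of small degree for as long as possible; if nothing is
  -- left, colour greedily in the reverse order.
  dense-or-colourable : ∀ k S →
    (∃₂ λ T u → u ∈ T × MinDegree≥ (suc k) T) ⊎ ColourableOn S (suc k)
  dense-or-colourable k S = go S (<-wellFounded ∣ S ∣)
    where
    go : ∀ S → Acc _<_ ∣ S ∣ → (∃₂ λ T u → u ∈ T × MinDegree≥ (suc k) T) ⊎ ColourableOn S (suc k)
    go S (acc rec) with any? (λ u → (u ∈? S) ×-dec (N (𝟏 S) u <? suc k))
    ... | yes (u , u∈S , N<k) with go (S - u) (rec (x∈p⇒∣p-x∣<∣p∣ u∈S))
    ...   | inj₁ dense = inj₁ dense
    ...   | inj₂ col   = inj₂ (colour-vertex S u N<k col)
    go S (acc rec) | no none with any? (_∈? S)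
    ...   | yes (u , u∈S) = inj₁ (S , u , u∈S , λ v∈S → ≮⇒≥ λ lt → none (_ , v∈S , lt))
    -- On the empty set any colouring is proper; `zero` exists because the number of colours is a
    -- successor.
    ...   | no  empty     = inj₂ ((λ _ → zero) , λ u∈S → contradiction (_ , u∈S) empty)

  -- Besides its neighbours in S, S contains `u` itself, which is not its own neighbour.
  minDegree<size : ∀ {k S u} → MinDegree≥ k S → u ∈ S → k < sum (𝟏 S)
  minDegree<size {k} {S} {u} dense u∈S = begin
    suc k                                      ≤⟨ s≤s (dense u∈S) ⟩
    suc (N (𝟏 S) u)                            ≡⟨ cong (_+ N (𝟏 S) u) (sym (sum-δ u)) ⟩
    sum (δ u) + N (𝟏 S) u                      ≡⟨ sym (∑-distrib-+ (δ u) (λ v → A u v * 𝟏 S v)) ⟩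
    ∑[ v < ∣V∣ ] (δ u v + A u v * 𝟏 S v)       ≤⟨ sum-mono bound ⟩
    sum (𝟏 S)                                  ∎
    where
    open ≤-Reasoning
    bound : ∀ v → δ u v + A u v * 𝟏 S v ≤ 𝟏 S v
    bound v with u ≟ v | adj? u v
    ... | yes refl | yes uu = contradiction uu (adj-irrefl refl)
    ... | yes refl | no  _  = 𝟙⁺ (u ∈? S) u∈S
    ... | no  _    | yes _  = ≤-reflexive (*-identityˡ _)
    ... | no  _    | no  _  = z≤n

  minDegree*size≤e : ∀ {k S} → MinDegree≥ k S → sum (𝟏 S) * k ≤ e (𝟏 S) (𝟏 S)
  minDegree*size≤e {k} {S} dense = ≤-trans (≤-reflexive (sym (sum-*ʳ k (𝟏 S)))) (sum-mono bound)
    where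
    bound : ∀ u → 𝟏 S u * k ≤ 𝟏 S u * N (𝟏 S) u
    bound u with u ∈? S
    ... | yes u∈S = *-monoʳ-≤ 1 (dense u∈S)
    ... | no  _   = z≤n

  chromatic≤B : ∀ {k} → Connected G → IsChromaticNumber G k → k ≤ B G
  chromatic≤B {k} conn (_ , minimal) = ≤B k (key k minimal)
    where
    open ≤-Reasoning
    key : ∀ k → (∀ j → Colourable G j → k ≤ j) → 2 ≤ k → k * k + 2 * ∣V∣ ≤ 2 * ∣E∣ + 3 * k
    key (suc zero) _ (s≤s ())
    -- For k = 2 the claim amounts to ∣V∣ ≤ ∣E∣ + 1, obtained by growing from one vertex.
    key 2 _ _ = begin
      4 + 2 * ∣V∣                     ≤⟨ +-monoʳ-≤ 4 (m≤n+m (2 * ∣V∣) (e (δ s) (δ s))) ⟩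
      4 + (e (δ s) (δ s) + 2 * ∣V∣)   ≤⟨ +-monoʳ-≤ 4 (spanning (δ s) conn (λ v → 𝟙≤1 (s ≟ v)) (𝟙⁺ (s ≟ s) refl)) ⟩
      4 + (2 * ∣E∣ + 2 * sum (δ s))   ≡⟨ cong (λ z → 4 + (2 * ∣E∣ + 2 * z)) (sum-δ s) ⟩
      4 + (2 * ∣E∣ + 2)               ≡⟨ arrange (2 * ∣E∣) ⟩
      2 * ∣E∣ + 6                     ∎
      where
      s = proj₁ (proj₁ conn)
      arrange : ∀ p → 4 + (p + 2) ≡ p + 6
      arrange = solve-∀
    -- Here k - 3 = m, and the number of colours tried is k - 1 = m + 2; success would contradict
    -- minimality of k.
    key k@(suc (suc (suc m))) minimal _ with dense-or-colourable (suc m) ⊤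
    ... | inj₂ (c , proper) = contradiction (minimal _ (c , proper ∈⊤ ∈⊤)) (<⇒≱ ≤-refl)
    ... | inj₁ (T , u , u∈T , dense) = begin
      k * k + 2 * ∣V∣              ≡⟨ split m (2 * ∣V∣) ⟩
      k * m + 2 * ∣V∣ + 3 * k      ≤⟨ +-monoˡ-≤ (3 * k) (+-monoˡ-≤ (2 * ∣V∣) (*-monoˡ-≤ m (minDegree<size dense u∈T))) ⟩
      p * m + 2 * ∣V∣ + 3 * k      ≤⟨ +-monoˡ-≤ (3 * k) (+-cancelˡ-≤ (2 * p) _ _ doubled) ⟩
      2 * ∣E∣ + 3 * k              ∎
      where
      p = sum (𝟏 T)
      split : ∀ m v → suc (suc (suc m)) * suc (suc (suc m)) + v ≡ suc (suc (suc m)) * m + v + 3 * suc (suc (suc m))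
      split = solve-∀
      merge : ∀ p m v → 2 * p + (p * m + v) ≡ p * suc (suc m) + v
      merge = solve-∀
      -- The degree sum is at least p(m + 2) = 2p + pm, and its 2p cancels the `2 * p` from
      -- `spanning`.
      doubled : 2 * p + (p * m + 2 * ∣V∣) ≤ 2 * p + 2 * ∣E∣
      doubled = begin
        2 * p + (p * m + 2 * ∣V∣)       ≡⟨ merge p m (2 * ∣V∣) ⟩
        p * suc (suc m) + 2 * ∣V∣       ≤⟨ +-monoˡ-≤ (2 * ∣V∣) (minDegree*size≤e dense) ⟩
        e (𝟏 T) (𝟏 T) + 2 * ∣V∣         ≤⟨ spanning (𝟏 T) {u} conn (λ v → 𝟙≤1 (v ∈? T)) (𝟙⁺ (u ∈? T) u∈T) ⟩
        2 * ∣E∣ + 2 * p                 ≡⟨ +-comm (2 * ∣E∣) (2 * p) ⟩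
        2 * p + 2 * ∣E∣                 ∎

corollary2p2p2 : (G : Graph) → Connected G →
    ((h : ℕ) → IsHadwigerNumber G h → h ≤ B G) × ((χ : ℕ) → IsChromaticNumber G χ → χ ≤ B G)
corollary2p2p2 G conn =
  (λ h (minor , _) → complete-minor≤B G conn minor) , (λ χ → chromatic≤B G conn)
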